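{- Let $G=(V,E)$ be a finite graph (loops and multiple edges allowed) with $|E|=n$, let $f\in \mathrm{Hom}_d(n)$ be a homogeneous function of degree $d$, let $e\in E$ be an edge of $G$, and let $s:E\to\Omega=\{1,\dots,n\}$ be a label of $G$. Then $$\chi_f(G(s);\lambda)=\widetilde f(s(e))\circ \chi_f(G(s)\backslash e;\lambda)-\chi_f(G(s)/e;\lambda).$$
   Context: Let $\Omega=\{1,\dots,n\}$ and $\Omega_d=\{Z\subset\Omega:|Z|=d\}$. $\mathrm{Hom}_d(n)$ is the real vector space of formal sums $f=\sum_{Z\in\Omega_d}f(Z)Z$, identified with functions $f:\Omega_d\to\mathbb R$. For $X\subset\Omega$ put $\widetilde f(X)=\sum_{Z\in\Omega_d,\,Z\subset X}f(Z)$. A label of $G=(V,E)$ with $|E|=n$ is a bijection $s:E\to\Omega$; $G(s)$ denotes $G$ with edges indexed by $s$. For $A\subset E$, $G_A=(V,A)$ and $k(G_A)$ is its number of connected components. The weighted chromatic polynomial is $$\chi_f(G(s);\lambda)=\sum_{A\subset E}\widetilde f(s(E\setminus A))(-1)^{|A|}\lambda^{k(G_A)}.$$ $G\backslash e$ is the graph obtained by removing $e$, and $G/e$ is obtained by identifying the end vertices of $e$ (and removing $e$), all other adjacencies being kept (so $G/e=G\backslash e$ if $e$ is a loop). $G(s)\backslash e$ and $G(s)/e$ have edge set $E\setminus\{e\}$, labelled by the restriction of $s$ (an injective map into the same $\Omega$), and $\chi_f$ of them is given by the same formula with the same $f$, with edge set $E\setminus\{e\}$ in place of $E$. Operator $\circ$: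 $\widetilde f(X)\circ\widetilde f(Y):=\widetilde f(X\cup Y)$, extended distributively over sums and scalar (polynomial) multiples. It acts on expressions regarded as formal linear combinations of the symbols $\widetilde f(Y)$, $Y\subset\Omega$; with $\widetilde f(s(e))=\widetilde f(\{s(e)\})$, the operation $\widetilde f(s(e))\circ$ replaces each symbol $\widetilde f(Y)$ by $\widetilde f(Y\cup\{s(e)\})$. Thus $\widetilde f(s(e))\circ\chi_f(G(s)\backslash e;\lambda)=\sum_{A\subset E\setminus\{e\}}\widetilde f\big(s((E\setminus\{e\})\setminus A)\cup\{s(e)\}\big)(-1)^{|A|}\lambda^{k((G\backslash e)_A)}$. -}

module Defs where

open import Algebra.Bundles using (CommutativeRing)
import Algebra.Properties.Semiring.Exp as Exp
open import Data.Fin.Base using (Fin; zero; suc; punchIn; punchOut)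
open import Data.Fin.Properties
  using (_≟_; any?; punchInᵢ≢i; punchOut-injective; punchOut-cong; punchOut-punchIn)
open import Data.Fin.Subset using (Subset; inside; outside; _∈_; _⊆_; _∪_; ∁; ∣_∣; ⁅_⁆)
open import Data.Fin.Subset.Properties using (_∈?_; _⊆?_)
open import Data.List.Base
  using (List; []; _∷_; _++_; map; foldr; filter; mapMaybe; replicate; cartesianProductWith)
import Data.Maybe.Base as Maybe
open import Data.Nat.Base using (ℕ; zero; suc; pred)
import Data.Nat.Properties as ℕ
open import Data.Product.Base using (Σ; ∃; _×_; _,_; proj₁; proj₂)
open import Data.Vec.Base using ([]; _∷_; here; there; tabulate)
open import Function.Base using (_∘_; id)
open import Function.Bundles using (_⤖_)
open import Function.Definitions using (StrictlySurjective)
open import Level using (0ℓ)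
open import Relation.Binary.Core using (Rel)
open import Relation.Binary.Construct.Closure.Equivalence as Eq using (EqClosure)
open import Relation.Binary.Construct.Closure.ReflexiveTransitive using (ε; _◅◅_)
open import Relation.Binary.PropositionalEquality
  using (_≡_; refl; sym; trans; cong; subst; isEquivalence)
open import Relation.Nullary.Decidable using (yes; no; does; dec⇒maybe; _×-dec_)
open import Relation.Nullary.Negation using (contradiction)

private
  variable
    m n : ℕ

------------------------------------------------------------------------
-- Quotients of Fin m

-- Fin m modulo the equivalence relation generated by R.  The fields determine
-- size, and determine class up to a permutation of Fin size.
record Quotient {m : ℕ} (R : Rel (Fin m) 0ℓ) : Set where
  field
    size       : ℕ
    class      : Fin m → Fin size
    surjective : StrictlySurjective _≡_ class
    sound      : ∀ {x y} → EqClosure R x y → class x ≡ class y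
    exact      : ∀ {x y} → class x ≡ class y → EqClosure R x y

open Quotient public

data Pair (u v : Fin m) : Rel (Fin m) 0ℓ where
  pair : Pair u v u v

discrete : (R : Rel (Fin m) 0ℓ) → (∀ {x y} → R x y → x ≡ y) → Quotient R
discrete {m} R R⇒≡ = record
  { size       = m
  ; class      = id
  ; surjective = λ x → x , refl
  ; sound      = Eq.fold isEquivalence R⇒≡
  ; exact      = λ { refl → ε }
  }

-- If u ≡ v this is the identity map; otherwise v is sent to the class of u
-- and the other elements are kept apart.
identify : (u v : Fin m) → Quotient (Pair u v)
identify {suc m} u v with v ≟ u
... | yes refl = discrete (Pair u v) λ { pair → refl }
... | no v≢u = record
  { size       = m
  ; class      = c
  ; surjective = λ i → punchIn v i , c-punchIn i
  ; sound      = Eq.gfold isEquivalence c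
                   λ { pair → trans cu (sym cv) }
  ; exact      = ex _ _
  }
  where
  c : Fin (suc m) → Fin m
  c w with v ≟ w
  ... | yes _   = punchOut v≢u
  ... | no  v≢w = punchOut v≢w

  cv : c v ≡ punchOut v≢u
  cv with v ≟ v
  ... | yes _   = refl
  ... | no  v≢v = contradiction refl v≢v

  cu : c u ≡ punchOut v≢u
  cu with v ≟ u
  ... | yes _ = refl
  ... | no  _ = punchOut-cong v refl

  c-punchIn : ∀ i → c (punchIn v i) ≡ i
  c-punchIn i with v ≟ punchIn v i
  ... | yes v≡ = contradiction (sym v≡) (punchInᵢ≢i v i)
  ... | no  _  = trans (punchOut-cong v refl) (punchOut-punchIn v)

  v∼u : EqClosure (Pair u v) v u
  v∼u = Eq.symmetric _ (Eq.return pair)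

  ex : ∀ x y → c x ≡ c y → EqClosure (Pair u v) x y
  ex x y eq with v ≟ x | v ≟ y
  ... | yes refl | yes refl = ε
  ... | yes refl | no  v≢y  = subst (EqClosure _ v) (punchOut-injective v≢u v≢y eq) v∼u
  ... | no  v≢x  | yes refl =
        subst (λ z → EqClosure _ z v) (sym (punchOut-injective v≢x v≢u eq)) (Eq.return pair)
  ... | no  v≢x  | no  v≢y  = subst (EqClosure _ x) (punchOut-injective v≢x v≢y eq) ε

------------------------------------------------------------------------
-- Graphs

-- Finite multigraphs.  The order in which the two ends of an edge are listed
-- is immaterial; an edge with equal ends is a loop.
record Graph : Set where
  field
    #V   : ℕ
    #E   : ℕ
    ends : Fin #E → Fin #V × Fin #V

open Graph public

Joins : (Fin n → Fin m × Fin m) → Subset n → Rel (Fin m) 0ℓ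
Joins ends A u v = ∃ λ e → e ∈ A × ends e ≡ (u , v)

quotientBy : (ends : Fin n → Fin m × Fin m) (A : Subset n) → Quotient (Joins ends A)
quotientBy {zero} ends A = discrete (Joins ends A) λ { (() , _) }
quotientBy {suc n} ends (outside ∷ A) = record
  { size       = size Q
  ; class      = class Q
  ; surjective = surjective Q
  ; sound      = sound Q ∘ Eq.map λ { (suc e , there e∈A , eq) → e , e∈A , eq }
  ; exact      = Eq.map (λ { (e , e∈A , eq) → suc e , there e∈A , eq }) ∘ exact Q
  }
  where Q = quotientBy (ends ∘ suc) A
quotientBy {suc n} {m} ends (inside ∷ A) = record
  { size       = size P
  ; class      = class P ∘ class Q
  ; surjective = λ i → let (j , eq) = surjective P i ; (x , eq′) = surjective Q j in
                   x , trans (cong (class P) eq′) eq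
  ; sound      = Eq.gfold isEquivalence (class P ∘ class Q) step
  ; exact      = λ {x} {y} eq → lift (exact P eq) x y refl refl
  }
  where
  u v : Fin m
  u = proj₁ (ends zero)
  v = proj₂ (ends zero)
  Q = quotientBy (ends ∘ suc) A
  P = identify (class Q u) (class Q v)

  R : Rel (Fin m) 0ℓ
  R = Joins ends (inside ∷ A)

  step : ∀ {x y} → R x y → class P (class Q x) ≡ class P (class Q y)
  step (zero  , _ , refl)         = sound P (Eq.return pair)
  step (suc e , there e∈A , refl) = cong (class P) (sound Q (Eq.return (e , e∈A , refl)))

  old : ∀ {x y} → class Q x ≡ class Q y → EqClosure R x y
  old = Eq.map (λ { (e , e∈A , eq) → suc e , there e∈A , eq }) ∘ exact Q

  -- The relation induced by R on the classes of Q.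
  S : Rel (Fin (size Q)) 0ℓ
  S i j = ∀ x y → class Q x ≡ i → class Q y ≡ j → EqClosure R x y

  lift : ∀ {i j} → EqClosure (Pair (class Q u) (class Q v)) i j → S i j
  lift = Eq.fold
    (record
      { refl  = λ x y p q → old (trans p (sym q))
      ; sym   = λ s x y p q → Eq.symmetric _ (s y x q p)
      ; trans = λ {_} {j} s t x y p q →
          let (z , eq) = surjective Q j in s x z p eq ◅◅ t z y eq q
      })
    λ { pair x y p q → old p ◅◅ (Eq.return (zero , here , refl) ◅◅ old (sym q)) }

-- The connected components of the spanning subgraph (V , A).
components : (G : Graph) (A : Subset (#E G)) → Quotient (Joins (ends G) A)
components G A = quotientBy (ends G) A

k : (G : Graph) → Subset (#E G) → ℕ
k G A = size (components G A)

-- E ∖ {e} is represented by Fin (pred #E), included in E by this map.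
keep : Fin n → Fin (pred n) → Fin n
keep {suc n} = punchIn

_∖_ : (G : Graph) → Fin (#E G) → Graph
G ∖ e = record { #V = #V G ; #E = pred (#E G) ; ends = ends G ∘ keep e }

-- Identifying the ends of a loop changes no vertex, so G / e is then G ∖ e.
_/_ : (G : Graph) → Fin (#E G) → Graph
G / e = record
  { #V   = size Q
  ; #E   = pred (#E G)
  ; ends = λ e′ → let (x , y) = ends G (keep e e′) in class Q x , class Q y
  }
  where Q = identify (proj₁ (ends G e)) (proj₂ (ends G e))

Label : Graph → ℕ → Set
Label G n = Fin (#E G) ⤖ Fin n

------------------------------------------------------------------------
-- Subsets

subsets : ∀ n → List (Subset n)
subsets zero    = [] ∷ []
subsets (suc n) = map (outside ∷_) (subsets n) ++ map (inside ∷_) (subsets n)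

image : (Fin m → Fin n) → Subset m → Subset n
image s X = tabulate λ j → does (any? λ i → (i ∈? X) ×-dec (s i ≟ j))

Ω : ℕ → ℕ → Set
Ω d n = Σ (Subset n) λ Z → ∣ Z ∣ ≡ d

enumerateΩ : ∀ d n → List (Ω d n)
enumerateΩ d n = mapMaybe (λ Z → Maybe.map (Z ,_) (dec⇒maybe (∣ Z ∣ ℕ.≟ d))) (subsets n)

------------------------------------------------------------------------
-- Weighted chromatic polynomials, with coefficients in a commutative ring

module WeightedChromatic {c ℓ} (R : CommutativeRing c ℓ) where

  open CommutativeRing R
    using (Carrier; _≈_; _+_; _*_; -_; 0#; 1#; semiring)
  open Exp semiring using (_^_)

  -- Polynomials in λ: the list of coefficients, constant term first.
  -- Trailing zeros are allowed.
  Poly : Set c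
  Poly = List Carrier

  coeff : Poly → ℕ → Carrier
  coeff []      _       = 0#
  coeff (a ∷ p) zero    = a
  coeff (a ∷ p) (suc i) = coeff p i

  infix  4 _≈ₚ_
  infixl 6 _+ₚ_ _-ₚ_
  infixl 7 _*ₚ_

  _≈ₚ_ : Rel Poly ℓ
  p ≈ₚ q = ∀ i → coeff p i ≈ coeff q i

  _+ₚ_ : Poly → Poly → Poly
  []      +ₚ q       = q
  (a ∷ p) +ₚ []      = a ∷ p
  (a ∷ p) +ₚ (b ∷ q) = (a + b) ∷ (p +ₚ q)

  _-ₚ_ : Poly → Poly → Poly
  p -ₚ q = p +ₚ map -_ q

  _*ₚ_ : Poly → Poly → Poly
  []      *ₚ q = []
  (a ∷ p) *ₚ q = map (a *_) q +ₚ (0# ∷ (p *ₚ q))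

  monomial : Carrier → ℕ → Poly
  monomial a i = replicate i 0# ++ (a ∷ [])

  const : Carrier → Poly
  const a = monomial a 0

  Hom : ℕ → ℕ → Set c
  Hom d n = Ω d n → Carrier

  tilde : ∀ {d n} → Hom d n → Subset n → Carrier
  tilde {d} {n} f X =
    foldr _+_ 0# (map f (filter (λ Z → proj₁ Z ⊆? X) (enumerateΩ d n)))

  -- Formal linear combinations, with polynomial coefficients, of the symbols
  -- f̃(Y) for Y ⊆ {1,…,n}: the list of (p , Y) stands for Σ p · f̃(Y).
  Formal : ℕ → Set c
  Formal n = List (Poly × Subset n)

  symbol : Subset n → Formal n
  symbol Y = (const 1# , Y) ∷ []

  infixr 7 _⊚_

  -- The operator f̃(X) ∘ f̃(Y) = f̃(X ∪ Y), extended bilinearly.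
  _⊚_ : Formal n → Formal n → Formal n
  _⊚_ = cartesianProductWith λ (p , X) (q , Y) → p *ₚ q , X ∪ Y

  value : ∀ {d n} → Hom d n → Formal n → Poly
  value f = foldr (λ (p , Y) r → p *ₚ const (tilde f Y) +ₚ r) []

  -- χ_f(G(s);λ) as a formal combination; applying value f gives the polynomial.
  χ : (G : Graph) → (Fin (#E G) → Fin n) → Formal n
  χ G s = map
    (λ A → monomial ((- 1#) ^ ∣ A ∣) (k G A) , image s (∁ A))
    (subsets (#E G))

{-# OPTIONS --safe #-}
-- The map A ↦ A ∪ {e} is a bijection from the subsets of E avoiding e to those
-- containing it, so χ_f(G(s)) splits into two sums over the subsets A of E ∖ {e}.
-- The terms without e are those of f̃(s(e)) ∘ χ_f(G(s) ∖ e), since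
-- s(E ∖ A) = s((E ∖ {e}) ∖ A) ∪ {s(e)} and k(G_A) = k((G ∖ e)_A); the terms with e
-- are those of − χ_f(G(s) / e), since E ∖ (A ∪ {e}) = (E ∖ {e}) ∖ A and
-- k(G_{A ∪ {e}}) = k((G / e)_A).
module Submission where

open import Defs
open import Algebra.Bundles using (CommutativeRing)
import Algebra.Properties.AbelianGroup as AbelianGroupProperties
import Algebra.Properties.CommutativeSemigroup as CommutativeSemigroupProperties
import Algebra.Properties.Ring as RingProperties
import Algebra.Properties.Semiring.Exp as Exp
open import Data.Fin.Base using (Fin; zero; suc; punchIn; punchOut)
open import Data.Fin.Properties using (_≟_; any?; injective⇒≤; punchIn-punchOut)
open import Data.Fin.Subset using (Subset; Side; inside; outside; _∈_; _∪_; ∁; ∣_∣; ⁅_⁆)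
open import Data.Fin.Subset.Properties
  using (_∈?_; x∈⁅x⁆; x∈⁅y⁆⇒x≡y; x∈p∪q⁺; x∈p∪q⁻; ⊆-antisym)
open import Data.List.Base using (List; []; _∷_; _++_; map; foldr)
open import Data.List.Properties using (++-identityʳ)
open import Data.Nat.Base using (ℕ; zero; suc; _≤_)
import Data.Nat.Properties as ℕ
open import Data.Product.Base using (∃; _×_; _,_; proj₁; proj₂)
open import Data.Sum.Base using (_⊎_; inj₁; inj₂)
open import Data.Vec.Base using ([]; _∷_; lookup; insertAt)
open import Data.Vec.Properties
  using (lookup∘tabulate; lookup⇒[]=; []=⇒lookup; insertAt-lookup; insertAt-punchIn; map-insertAt)
open import Function.Base using (_∘_)
open import Function.Bundles using (module Bijection)
open import Function.Definitions using (StrictlySurjective)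
import Relation.Binary.Construct.Closure.Equivalence as Eq
open import Relation.Binary.PropositionalEquality
  using (_≡_; refl; sym; trans; cong; cong₂; subst; isEquivalence)
import Relation.Binary.Reasoning.Setoid as SetoidReasoning
open import Relation.Nullary.Decidable using (yes; no; proof; dec-true; _×-dec_)
open import Relation.Nullary.Reflects using (Reflects; invert)

private
  variable
    m n a b : ℕ

-- The split of E into `e` and the other edges, given by equations so that matching on `refl`
-- replaces `i` by `e` or by `punchIn e j`.
≡⊎punchIn : ∀ (e i : Fin (suc n)) → i ≡ e ⊎ ∃ λ j → i ≡ punchIn e j
≡⊎punchIn e i with e ≟ i
... | yes e≡i = inj₁ (sym e≡i)
... | no  e≢i = inj₂ (punchOut e≢i , sym (punchIn-punchOut e≢i))

-- Subsets

-- For a set A of edges other than `e`, `insertAt A e outside` is A seen as a subset of E, and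
-- `insertAt A e inside` is A ∪ {e}.
∣insertAt-outside∣ : ∀ (A : Subset n) e → ∣ insertAt A e outside ∣ ≡ ∣ A ∣
∣insertAt-outside∣ A             zero    = refl
∣insertAt-outside∣ (outside ∷ A) (suc e) = ∣insertAt-outside∣ A e
∣insertAt-outside∣ (inside  ∷ A) (suc e) = cong suc (∣insertAt-outside∣ A e)

-- This `suc` is the source of the minus sign before the contraction term.
∣insertAt-inside∣ : ∀ (A : Subset n) e → ∣ insertAt A e inside ∣ ≡ suc ∣ A ∣
∣insertAt-inside∣ A             zero    = refl
∣insertAt-inside∣ (outside ∷ A) (suc e) = ∣insertAt-inside∣ A e
∣insertAt-inside∣ (inside  ∷ A) (suc e) = cong suc (∣insertAt-inside∣ A e)

∈-insertAt-inside : ∀ (A : Subset n) e → e ∈ insertAt A e inside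
∈-insertAt-inside A e = lookup⇒[]= e _ (insertAt-lookup A e inside)

∈-insertAt⁺ : ∀ (A : Subset n) e (t : Side) {j} → j ∈ A → punchIn e j ∈ insertAt A e t
∈-insertAt⁺ A e t {j} j∈A =
  lookup⇒[]= _ _ (trans (insertAt-punchIn A e t j) ([]=⇒lookup j∈A))

∈-insertAt⁻ : ∀ (A : Subset n) e (t : Side) {j} → punchIn e j ∈ insertAt A e t → j ∈ A
∈-insertAt⁻ A e t {j} j∈ =
  lookup⇒[]= j A (trans (sym (insertAt-punchIn A e t j)) ([]=⇒lookup j∈))

∉-insertAt-outside : ∀ (A : Subset n) e {c} {C : Set c} → e ∈ insertAt A e outside → C
∉-insertAt-outside A e e∈ with () ← trans (sym ([]=⇒lookup e∈)) (insertAt-lookup A e outside)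

∈-image⁺ : ∀ (s : Fin m → Fin n) (X : Subset m) {i} → i ∈ X → s i ∈ image s X
∈-image⁺ s X {i} i∈X = lookup⇒[]= (s i) _ (trans (lookup∘tabulate _ (s i))
  (dec-true (any? λ i′ → (i′ ∈? X) ×-dec (s i′ ≟ s i)) (i , i∈X , refl)))

∈-image⁻ : ∀ (s : Fin m → Fin n) (X : Subset m) {j} → j ∈ image s X → ∃ λ i → i ∈ X × s i ≡ j
-- `image` keeps only the boolean `does`. Membership says that it is `inside`, that is `true`; at
-- this index the `Reflects` proof yields a preimage.
∈-image⁻ s X {j} j∈ = invert (subst (Reflects _)
  (trans (sym (lookup∘tabulate _ j)) ([]=⇒lookup j∈))
  (proof (any? λ i → (i ∈? X) ×-dec (s i ≟ j))))

image-insertAt-outside : ∀ (s : Fin (suc m) → Fin n) (X : Subset m) e →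
  image s (insertAt X e outside) ≡ image (s ∘ punchIn e) X
image-insertAt-outside s X e = ⊆-antisym to from
  where
  to : ∀ {j} → j ∈ image s (insertAt X e outside) → j ∈ image (s ∘ punchIn e) X
  to j∈ with ∈-image⁻ s _ j∈
  ... | i , i∈ , refl with ≡⊎punchIn e i
  ...   | inj₁ refl       = ∉-insertAt-outside X e i∈
  ...   | inj₂ (_ , refl) = ∈-image⁺ (s ∘ punchIn e) X (∈-insertAt⁻ X e outside i∈)

  from : ∀ {j} → j ∈ image (s ∘ punchIn e) X → j ∈ image s (insertAt X e outside)
  from j∈ with ∈-image⁻ (s ∘ punchIn e) X j∈
  ... | i , i∈ , refl = ∈-image⁺ s _ (∈-insertAt⁺ X e outside i∈)

image-insertAt-inside : ∀ (s : Fin (suc m) → Fin n) (X : Subset m) e →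
  image s (insertAt X e inside) ≡ ⁅ s e ⁆ ∪ image (s ∘ punchIn e) X
image-insertAt-inside s X e = ⊆-antisym to from
  where
  to : ∀ {j} → j ∈ image s (insertAt X e inside) → j ∈ ⁅ s e ⁆ ∪ image (s ∘ punchIn e) X
  to j∈ with ∈-image⁻ s _ j∈
  ... | i , i∈ , refl with ≡⊎punchIn e i
  ...   | inj₁ refl       = x∈p∪q⁺ (inj₁ (x∈⁅x⁆ (s e)))
  ...   | inj₂ (_ , refl) =
          x∈p∪q⁺ (inj₂ (∈-image⁺ (s ∘ punchIn e) X (∈-insertAt⁻ X e inside i∈)))

  from : ∀ {j} → j ∈ ⁅ s e ⁆ ∪ image (s ∘ punchIn e) X → j ∈ image s (insertAt X e inside)
  from j∈ with x∈p∪q⁻ ⁅ s e ⁆ _ j∈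
  ... | inj₁ j∈⁅se⁆ rewrite x∈⁅y⁆⇒x≡y (s e) j∈⁅se⁆ = ∈-image⁺ s _ (∈-insertAt-inside X e)
  ... | inj₂ j∈im with ∈-image⁻ (s ∘ punchIn e) X j∈im
  ...   | i , i∈ , refl = ∈-image⁺ s _ (∈-insertAt⁺ X e inside i∈)

-- `∁` acts entrywise, so it flips the inserted side: choosing `e` leaves its label out of the
-- symbol, and omitting `e` puts the label in.
image-∁-insertAt-inside : ∀ (s : Fin (suc m) → Fin n) (A : Subset m) e →
  image s (∁ (insertAt A e inside)) ≡ image (s ∘ punchIn e) (∁ A)
image-∁-insertAt-inside s A e =
  trans (cong (image s) (map-insertAt _ inside A e)) (image-insertAt-outside s (∁ A) e)

image-∁-insertAt-outside : ∀ (s : Fin (suc m) → Fin n) (A : Subset m) e →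
  image s (∁ (insertAt A e outside)) ≡ ⁅ s e ⁆ ∪ image (s ∘ punchIn e) (∁ A)
image-∁-insertAt-outside s A e =
  trans (cong (image s) (map-insertAt _ outside A e)) (image-insertAt-inside s (∁ A) e)

-- Numbers of components

-- Choosing a preimage under `g` and applying `f` to it is injective. Used in both directions, this
-- compares numbers of classes without building a bijection between them.
kernel-⊆⇒≤ : ∀ (f : Fin m → Fin a) (g : Fin m → Fin b) → StrictlySurjective _≡_ g →
  (∀ {x y} → f x ≡ f y → g x ≡ g y) → b ≤ a
kernel-⊆⇒≤ f g g-surj ker⊆ = injective⇒≤ {f = f ∘ proj₁ ∘ g-surj} λ {i} {j} eq →
  trans (sym (proj₂ (g-surj i))) (trans (ker⊆ eq) (proj₂ (g-surj j)))

module _ (ends : Fin (suc n) → Fin m × Fin m) (e : Fin (suc n)) (A : Subset n) where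

  -- `e` is outside the set, so both relations have the same pairs and generate the same
  -- equivalence.
  size-delete : size (quotientBy ends (insertAt A e outside))
              ≡ size (quotientBy (ends ∘ punchIn e) A)
  size-delete = ℕ.≤-antisym
    (kernel-⊆⇒≤ (class D) (class K) (surjective K) (sound K ∘ Eq.map D⇒K ∘ exact D))
    (kernel-⊆⇒≤ (class K) (class D) (surjective D) (sound D ∘ Eq.map K⇒D ∘ exact K))
    where
    K = quotientBy ends (insertAt A e outside)
    D = quotientBy (ends ∘ punchIn e) A

    D⇒K : ∀ {x y} → Joins (ends ∘ punchIn e) A x y → Joins ends (insertAt A e outside) x y
    D⇒K (j , j∈ , eq) = punchIn e j , ∈-insertAt⁺ A e outside j∈ , eq

    K⇒D : ∀ {x y} → Joins ends (insertAt A e outside) x y → Joins (ends ∘ punchIn e) A x y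
    K⇒D (i , i∈ , eq) with ≡⊎punchIn e i
    ... | inj₁ refl       = ∉-insertAt-outside A e i∈
    ... | inj₂ (j , refl) = j , ∈-insertAt⁻ A e outside i∈ , eq

  private
    P : Quotient (Pair (proj₁ (ends e)) (proj₂ (ends e)))
    P = identify (proj₁ (ends e)) (proj₂ (ends e))

    -- This is `ends (G / e)` unfolded, so that `size-contract` applies to `k (G / e) A` by
    -- computation.
    contracted : Fin n → Fin (size P) × Fin (size P)
    contracted j = let (x , y) = ends (punchIn e j) in class P x , class P y

  -- Both numbers count classes of the original vertices: `class K` and `class D ∘ class P` are
  -- surjections with the same kernel. One inclusion is checked edge by edge in `step`; for the
  -- other, `class K` factors through `P`.
  size-contract : size (quotientBy ends (insertAt A e inside)) ≡ size (quotientBy contracted A)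
  size-contract = ℕ.≤-antisym
    (kernel-⊆⇒≤ (class D ∘ class P) (class K) (surjective K) ker⊆)
    (kernel-⊆⇒≤ (class K) (class D ∘ class P) surj
      (Eq.gfold isEquivalence (class D ∘ class P) step ∘ exact K))
    where
    K = quotientBy ends (insertAt A e inside)
    D = quotientBy contracted A

    surj : StrictlySurjective _≡_ (class D ∘ class P)
    surj i = let (j , eq) = surjective D i ; (x , eq′) = surjective P j in
      x , trans (cong (class D) eq′) eq

    step : ∀ {x y} → Joins ends (insertAt A e inside) x y →
      class D (class P x) ≡ class D (class P y)
    step (i , i∈ , refl) with ≡⊎punchIn e i
    ... | inj₁ refl       = cong (class D) (sound P (Eq.return pair))
    ... | inj₂ (j , refl) = sound D (Eq.return (j , ∈-insertAt⁻ A e inside i∈ , refl))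

    -- The map that class K induces on the classes of P.
    g : Fin (size P) → Fin (size K)
    g = class K ∘ proj₁ ∘ surjective P

    -- The chosen representative of `class P x` may differ from `x`, but `exact P` links the two
    -- through the ends of `e`, which `K` merges.
    g-class : ∀ x → g (class P x) ≡ class K x
    g-class x = Eq.gfold isEquivalence (class K)
      (λ { pair → sound K (Eq.return (e , ∈-insertAt-inside A e , refl)) })
      (exact P (proj₂ (surjective P (class P x))))

    g-step : ∀ {i j} → Joins contracted A i j → g i ≡ g j
    g-step (j , j∈ , refl) = trans (g-class _) (trans
      (sound K (Eq.return (punchIn e j , ∈-insertAt⁺ A e inside j∈ , refl)))
      (sym (g-class _)))

    ker⊆ : ∀ {x y} → class D (class P x) ≡ class D (class P y) → class K x ≡ class K y
    ker⊆ {x} {y} eq = trans (sym (g-class x)) (trans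
      (Eq.gfold isEquivalence g g-step (exact D eq)) (g-class y))

module _ {c ℓ} (R : CommutativeRing c ℓ) where

  open WeightedChromatic R
  open CommutativeRing R
    using ( Carrier; _≈_; _+_; _*_; -_; 0#; 1#; setoid; semiring; ring; reflexive
          ; +-cong; +-congˡ; +-congʳ; +-assoc; +-identityˡ; +-identityʳ; -‿cong
          ; *-congʳ; *-identityˡ; zeroˡ; zeroʳ
          ; +-abelianGroup; +-commutativeSemigroup)
    renaming (refl to ≈-refl; sym to ≈-sym; trans to ≈-trans)
  open RingProperties ring using (-0#≈0#; -1*x≈-x; -‿distribˡ-*)
  open AbelianGroupProperties +-abelianGroup using (⁻¹-∙-comm)
  open CommutativeSemigroupProperties +-commutativeSemigroup using (interchange)
  open Exp semiring using (_^_)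
  open SetoidReasoning setoid

  -- Finite sums

  ∑ : ∀ {x} {X : Set x} → (X → Carrier) → List X → Carrier
  ∑ g = foldr (λ x → g x +_) 0#

  ∑-cong : ∀ {x} {X : Set x} {g h : X → Carrier} → (∀ x → g x ≈ h x) → ∀ xs → ∑ g xs ≈ ∑ h xs
  ∑-cong g≈h []       = ≈-refl
  ∑-cong g≈h (x ∷ xs) = +-cong (g≈h x) (∑-cong g≈h xs)

  ∑-map : ∀ {x y} {X : Set x} {Y : Set y} (g : Y → Carrier) (h : X → Y) xs →
    ∑ g (map h xs) ≡ ∑ (g ∘ h) xs
  ∑-map g h []       = refl
  ∑-map g h (x ∷ xs) = cong (g (h x) +_) (∑-map g h xs)

  ∑-++ : ∀ {x} {X : Set x} (g : X → Carrier) xs ys → ∑ g (xs ++ ys) ≈ ∑ g xs + ∑ g ys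
  ∑-++ g []       ys = ≈-sym (+-identityˡ _)
  ∑-++ g (x ∷ xs) ys = ≈-trans (+-congˡ (∑-++ g xs ys)) (≈-sym (+-assoc _ _ _))

  ∑-neg : ∀ {x} {X : Set x} (g : X → Carrier) xs → ∑ (λ x → - g x) xs ≈ - ∑ g xs
  ∑-neg g []       = ≈-sym -0#≈0#
  ∑-neg g (x ∷ xs) = ≈-trans (+-congˡ (∑-neg g xs)) (⁻¹-∙-comm _ _)

  ∑-subsets-suc : ∀ (g : Subset (suc n) → Carrier) →
    ∑ g (subsets (suc n)) ≈ ∑ (g ∘ (outside ∷_)) (subsets n) + ∑ (g ∘ (inside ∷_)) (subsets n)
  ∑-subsets-suc {n} g = ≈-trans
    (∑-++ g (map (outside ∷_) (subsets n)) _)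
    (+-cong (reflexive (∑-map g _ (subsets n))) (reflexive (∑-map g _ (subsets n))))

  -- `subsets` branches on the first element, which settles `zero`; induction moves the branching to
  -- position `e`.
  ∑-subsets-insertAt : ∀ (e : Fin (suc n)) (g : Subset (suc n) → Carrier) →
    ∑ g (subsets (suc n)) ≈ ∑ (λ A → g (insertAt A e outside)) (subsets n)
                          + ∑ (λ A → g (insertAt A e inside)) (subsets n)
  ∑-subsets-insertAt zero g = ∑-subsets-suc g
  ∑-subsets-insertAt {suc n} (suc e) g = begin
    ∑ g (subsets (suc (suc n)))
      ≈⟨ ∑-subsets-suc g ⟩
    ∑ (g ∘ (outside ∷_)) (subsets (suc n)) + ∑ (g ∘ (inside ∷_)) (subsets (suc n))
      ≈⟨ +-cong (∑-subsets-insertAt e _) (∑-subsets-insertAt e _) ⟩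
    -- Four sums, grouped by the side of the first element, are regrouped by the side of `suc e`.
    _ ≈⟨ interchange _ _ _ _ ⟩
    _
      ≈⟨ +-cong (∑-subsets-suc (λ A → g (insertAt A (suc e) outside)))
                (∑-subsets-suc (λ A → g (insertAt A (suc e) inside))) ⟨
    _ ∎

  -- Coefficients

  coeff-+ : ∀ p q i → coeff (p +ₚ q) i ≈ coeff p i + coeff q i
  coeff-+ []      q       i       = ≈-sym (+-identityˡ _)
  coeff-+ (x ∷ p) []      i       = ≈-sym (+-identityʳ _)
  coeff-+ (x ∷ p) (y ∷ q) zero    = ≈-refl
  coeff-+ (x ∷ p) (y ∷ q) (suc i) = coeff-+ p q i

  coeff-neg : ∀ p i → coeff (map -_ p) i ≈ - coeff p i
  coeff-neg []      i       = ≈-sym -0#≈0#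
  coeff-neg (x ∷ p) zero    = ≈-refl
  coeff-neg (x ∷ p) (suc i) = coeff-neg p i

  coeff-*-const : ∀ p x i → coeff (p *ₚ const x) i ≈ coeff p i * x
  coeff-*-const []      x i       = ≈-sym (zeroˡ x)
  -- As `const x` has one entry, the recursion of `*ₚ` adds only `0#` to the head and leaves the
  -- rest to the shifted product.
  coeff-*-const (y ∷ p) x zero    = +-identityʳ _
  coeff-*-const (y ∷ p) x (suc i) = coeff-*-const p x i

  coeff-scale : ∀ x p i → coeff (map (x *_) p) i ≈ x * coeff p i
  coeff-scale x []      i       = ≈-sym (zeroʳ x)
  coeff-scale x (y ∷ p) zero    = ≈-refl
  coeff-scale x (y ∷ p) (suc i) = coeff-scale x p i

  -- The trailing zero that `const 1# *ₚ p` adds, coming from the shifted empty product.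
  coeff-0∷[] : ∀ i → coeff (0# ∷ []) i ≈ 0#
  coeff-0∷[] zero    = ≈-refl
  coeff-0∷[] (suc i) = ≈-refl

  coeff-1-* : ∀ p i → coeff (const 1# *ₚ p) i ≈ coeff p i
  coeff-1-* p i = begin
    coeff (const 1# *ₚ p) i                       ≈⟨ coeff-+ (map (1# *_) p) (0# ∷ []) i ⟩
    coeff (map (1# *_) p) i + coeff (0# ∷ []) i   ≈⟨ +-cong (coeff-scale 1# p i) (coeff-0∷[] i) ⟩
    1# * coeff p i + 0#                           ≈⟨ +-identityʳ _ ⟩
    1# * coeff p i                                ≈⟨ *-identityˡ _ ⟩
    coeff p i                                     ∎

  -- At position `r` the power unfolds to one more factor `- 1#`; elsewhere both sides vanish.
  coeff-monomial-suc-^ : ∀ j r i →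
    coeff (monomial ((- 1#) ^ suc j) r) i ≈ - coeff (monomial ((- 1#) ^ j) r) i
  coeff-monomial-suc-^ j zero    zero    = -1*x≈-x _
  coeff-monomial-suc-^ j zero    (suc i) = ≈-sym -0#≈0#
  coeff-monomial-suc-^ j (suc r) zero    = ≈-sym -0#≈0#
  coeff-monomial-suc-^ j (suc r) (suc i) = coeff-monomial-suc-^ j r i

  -- Values of formal combinations

  module _ {d n} (f : Hom d n) (i : ℕ) where

    -- Since `≈ₚ` is coefficientwise, fixing `i` reduces the theorem to an identity of finite sums
    -- in the ring.
    coeffTerm : Poly × Subset n → Carrier
    coeffTerm (p , Y) = coeff p i * tilde f Y

    coeff-value : ∀ L → coeff (value f L) i ≈ ∑ coeffTerm L
    coeff-value []            = ≈-refl
    coeff-value ((p , Y) ∷ L) = ≈-trans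
      (coeff-+ (p *ₚ const (tilde f Y)) _ i)
      (+-cong (coeff-*-const p _ i) (coeff-value L))

    coeff-value-symbol-⊚ : ∀ Y L → coeff (value f (symbol Y ⊚ L)) i
                                 ≈ ∑ (λ (p , Z) → coeffTerm (p , Y ∪ Z)) L
    coeff-value-symbol-⊚ Y L = begin
      coeff (value f (symbol Y ⊚ L)) i
        ≈⟨ coeff-value (symbol Y ⊚ L) ⟩
      ∑ coeffTerm (map (λ (p , Z) → const 1# *ₚ p , Y ∪ Z) L ++ [])
        -- The `[]` is the product of `L` with the empty rest of the one-element list `symbol Y`.
        ≡⟨ cong (∑ coeffTerm) (++-identityʳ (map (λ (p , Z) → const 1# *ₚ p , Y ∪ Z) L)) ⟩
      ∑ coeffTerm (map (λ (p , Z) → const 1# *ₚ p , Y ∪ Z) L)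
        ≡⟨ ∑-map coeffTerm _ L ⟩
      ∑ (λ (p , Z) → coeffTerm (const 1# *ₚ p , Y ∪ Z)) L
        ≈⟨ ∑-cong (λ (p , Z) → *-congʳ (coeff-1-* p i)) L ⟩
      ∑ (λ (p , Z) → coeffTerm (p , Y ∪ Z)) L ∎

  -- Deletion and contraction

  χTerm : ∀ (G : Graph) → (Fin (#E G) → Fin n) → Subset (#E G) → Poly × Subset n
  χTerm G s A = monomial ((- 1#) ^ ∣ A ∣) (k G A) , image s (∁ A)

  deletion-contraction : ∀ {d} (G : Graph) (f : Hom d n) (e : Fin (#E G)) (s : Fin (#E G) → Fin n) →
    value f (χ G s) ≈ₚ value f (symbol ⁅ s e ⁆ ⊚ χ (G ∖ e) (s ∘ keep e))
                       -ₚ value f (χ (G / e) (s ∘ keep e))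
  -- The edge `e` forces `#E` to be a successor; matching on it makes `keep e` compute to
  -- `punchIn e`.
  deletion-contraction G@(record { #E = suc N ; ends = ends }) f e s i = begin
    coeff (value f (χ G s)) i
      ≈⟨ coeff-value f i (χ G s) ⟩
    ∑ term (χ G s)
      ≡⟨ ∑-map term (χTerm G s) (subsets (suc N)) ⟩
    ∑ (term ∘ χTerm G s) (subsets (suc N))
      ≈⟨ ∑-subsets-insertAt e (term ∘ χTerm G s) ⟩
    ∑ (λ A → term (χTerm G s (insertAt A e outside))) (subsets N)
      + ∑ (λ A → term (χTerm G s (insertAt A e inside))) (subsets N)
      ≈⟨ +-cong (∑-cong without (subsets N)) (∑-cong within (subsets N)) ⟩
    ∑ (joined ∘ χTerm (G ∖ e) s′) (subsets N)
      + ∑ (λ A → - term (χTerm (G / e) s′ A)) (subsets N)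
      ≈⟨ +-congˡ (∑-neg (term ∘ χTerm (G / e) s′) (subsets N)) ⟩
    ∑ (joined ∘ χTerm (G ∖ e) s′) (subsets N) + - ∑ (term ∘ χTerm (G / e) s′) (subsets N)
      ≡⟨ cong₂ (λ x y → x + - y) (∑-map joined (χTerm (G ∖ e) s′) (subsets N))
                                 (∑-map term (χTerm (G / e) s′) (subsets N)) ⟨
    ∑ joined (χ (G ∖ e) s′) + - ∑ term (χ (G / e) s′)
      ≈⟨ +-cong (coeff-value-symbol-⊚ f i ⁅ s e ⁆ (χ (G ∖ e) s′))
                (-‿cong (coeff-value f i (χ (G / e) s′))) ⟨
    coeff (value f (symbol ⁅ s e ⁆ ⊚ χ (G ∖ e) s′)) i + - coeff (value f (χ (G / e) s′)) i
      ≈⟨ +-congˡ (coeff-neg (value f (χ (G / e) s′)) i) ⟨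
    coeff (value f (symbol ⁅ s e ⁆ ⊚ χ (G ∖ e) s′)) i + coeff (map -_ (value f (χ (G / e) s′))) i
      ≈⟨ coeff-+ (value f (symbol ⁅ s e ⁆ ⊚ χ (G ∖ e) s′)) _ i ⟨
    coeff (value f (symbol ⁅ s e ⁆ ⊚ χ (G ∖ e) s′) -ₚ value f (χ (G / e) s′)) i ∎
    where
    s′ = s ∘ punchIn e

    term joined : Poly × Subset _ → Carrier
    term = coeffTerm f i
    joined (p , Z) = term (p , ⁅ s e ⁆ ∪ Z)

    without : ∀ A → term (χTerm G s (insertAt A e outside)) ≈ joined (χTerm (G ∖ e) s′ A)
    without A = reflexive (cong₂ (λ p Y → term (p , Y))
      (cong₂ (λ j r → monomial ((- 1#) ^ j) r) (∣insertAt-outside∣ A e) (size-delete ends e A))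
      (image-∁-insertAt-outside s A e))

    within : ∀ A → term (χTerm G s (insertAt A e inside)) ≈ - term (χTerm (G / e) s′ A)
    within A = begin
      term (χTerm G s (insertAt A e inside))
        ≡⟨ cong₂ (λ p Y → term (p , Y))
             (cong₂ (λ j r → monomial ((- 1#) ^ j) r)
               (∣insertAt-inside∣ A e) (size-contract ends e A))
             (image-∁-insertAt-inside s A e) ⟩
      term (monomial ((- 1#) ^ suc ∣ A ∣) (k (G / e) A) , image s′ (∁ A))
        -- The extra factor `- 1#` due to `e` leaves first the coefficient, then the product.
        ≈⟨ *-congʳ (coeff-monomial-suc-^ ∣ A ∣ (k (G / e) A) i) ⟩
      (- coeff (monomial ((- 1#) ^ ∣ A ∣) (k (G / e) A)) i) * tilde f (image s′ (∁ A))
        ≈⟨ -‿distribˡ-* _ _ ⟨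
      - term (χTerm (G / e) s′ A) ∎

proposition3p1 : ∀ {c ℓ} (R : CommutativeRing c ℓ) →
    let open WeightedChromatic R in
    (n d : ℕ) (G : Graph) → #E G ≡ n →
    (f : Hom d n) (e : Fin (#E G)) (label : Label G n) →
    let s = Bijection.to label in
    value f (χ G s)
    ≈ₚ value f (symbol ⁅ s e ⁆ ⊚ χ (G ∖ e) (s ∘ keep e))
    -ₚ value f (χ (G / e) (s ∘ keep e))
proposition3p1 R n d G _ f e label = deletion-contraction R G f e (Bijection.to label)
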